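{- Let $V$ be a $P_1$-algorithm, let the $i$-th step of $V$ be a main step (for a fixed distribution $d$ of checked subsets into steps), and let $S,T$ be two input-sets from the input-class $V_{input}(n,d)$ such that $S$ results in a subset-solution being determined as checked subset in the (only) place of the $i$-th step (outcome $1$) and $T$ results in no subset-solution being determined as checked subset in the $i$-th step (outcome $0$). For $q=\frac{a}{b}\in\mathbb{Q}\cap[0,1]$ with $a,b\in\mathbb{N}$, $b\neq 0$, $a\le b$, let $X_q\in\{0,1\}$ be the outcome of an input-set selected uniformly at random from the box $B_{a/b}$, which consists of $a$ instances of $S$ and $b-a$ instances of $T$, and let $p_1(q)=\mathrm{prob}\{X_q=1\}$. Then the function $p_1:\mathbb{Q}\cap[0,1]\to[0,1]$ is given by $p_1(q)=q$ and is continuous.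
   Context: Subset-sum problem: given a set of $n$ integers (an input-set), decide whether some non-empty subset sums to zero; such a subset is called a subset-solution. Only algorithms that determine, for every non-empty subset of the input-set, whether it is a subset-solution are considered. An algorithm checks a subset in a step if in that step it performs the final necessary operation to determine that subset independently of the other subsets; a step in which checking takes place is a main step. A $P_1$-algorithm is one for which only one subset is checked in each main step. The number of steps is taken to be the worst-case number for input-sets of size $n$ (empty steps are added if fewer are needed). A distribution is the tuple $d=(d_1,\dots,d_k)$, where $k$ is the number of steps and $d_j$ is the number of subsets checked in step $j$. An input-class $V_{input}(n,d)$ is a class containing infinitely many input-sets of size $n$ that result in the same distribution $d$ for $V$. For the random experiment, each of $S$ and $T$ has a fixed outcome: the outcome of $S$ is $1$ and the outcome of $T$ is $0$. The box $B_{a/b}$ is the multiset of cardinality $b$ with $a$ instances of $S$ and $b-a$ instances of $T$; all $b$ instances are equally likely to be selected. For a given $q$, any box $B_{a/b}$ with $\frac{a}{b}=q$ may be used. $\mathbb{N}$ includes $0$. $\mathbb{Q}\cap[0,1]$ and $[0,1]$ carry the topology induced from $\mathbb{R}$. -}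

module Defs where

open import Data.Bool.Base using (Bool; if_then_else_; T)
open import Data.Fin.Base using (Fin; toℕ)
open import Data.Fin.Subset using (Subset; Nonempty; inside; outside)
open import Data.Fin.Subset.Properties using (nonempty?; anySubset?)
open import Data.Integer.Base as ℤ using (ℤ; +_; 0ℤ)
import Data.Integer.Properties as ℤ
open import Data.List.Base as List using (List)
open import Data.List.Membership.Propositional using (_∈_)
open import Data.Maybe.Base using (Maybe; just; is-just; is-nothing)
open import Data.Nat.Base as ℕ using (ℕ; zero; suc; NonZero)
import Data.Nat.Properties as ℕ
open import Data.Product.Base using (Σ; ∃; _×_; _,_)
open import Data.Rational.Base as ℚ using (ℚ; 0ℚ; 1ℚ; _/_)
import Data.Rational.Properties as ℚ
open import Data.Rational.Unnormalised.Base using (mkℚᵘ; *≤*)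
import Data.Rational.Unnormalised.Properties as ℚᵘ
open import Data.Sum.Base using (_⊎_; inj₁; inj₂)
open import Data.Vec.Base as Vec using (Vec; []; _∷_)
open import Data.Vec.Properties using (count≤n)
open import Data.Vec.Relation.Unary.Linked using (Linked)
open import Function.Base using (_∘_)
open import Function.Bundles using (_⇔_; mk⇔)
open import Level using (Level; 0ℓ; _⊔_) renaming (suc to lsuc)
open import Relation.Binary.Definitions using (tri<; tri≈; tri>)
open import Relation.Binary.PropositionalEquality using (_≡_; refl; sym; subst; subst₂)
open import Relation.Nullary using (¬_; Dec; does)
open import Relation.Nullary.Decidable using (_×-dec_; T?)
open import Relation.Unary using (Pred; Decidable)

private
  variable
    c ℓ : Level
    A : Set c
    n : ℕ

------------------------------------------------------------------------
-- Subset-sum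

-- A set of n integers is represented by its strictly increasing enumeration,
-- so that distinct values of type InputSet n are distinct sets.
record InputSet (n : ℕ) : Set where
  constructor inputSet
  field
    elements    : Vec ℤ n
    .increasing : Linked ℤ._<_ elements

open InputSet public

subsetSum : Vec ℤ n → Subset n → ℤ
subsetSum []       []            = 0ℤ
subsetSum (z ∷ zs) (inside  ∷ s) = z ℤ.+ subsetSum zs s
subsetSum (z ∷ zs) (outside ∷ s) = subsetSum zs s

IsSubsetSolution : InputSet n → Subset n → Set
IsSubsetSolution x s = Nonempty s × subsetSum (elements x) s ≡ 0ℤ

isSubsetSolution? : (x : InputSet n) → Decidable (IsSubsetSolution x)
isSubsetSolution? x s = nonempty? s ×-dec (subsetSum (elements x) s ℤ.≟ 0ℤ)

allSubsets : ∀ n → List (Subset n)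
allSubsets zero    = List.[ [] ]
allSubsets (suc n) =
  List.map (inside ∷_) (allSubsets n) List.++ List.map (outside ∷_) (allSubsets n)

------------------------------------------------------------------------
-- Algorithms

-- `verdict σ s` is what has been determined, in state σ, about the subset s
-- itself: `nothing` if s is still undetermined, `just true` if s is known to be
-- a subset-solution, `just false` if it is known not to be one.
record Machine : Set₁ where
  field
    State   : ℕ → Set
    init    : InputSet n → State n
    step    : State n → State n
    halted  : State n → Bool
    verdict : State n → Subset n → Maybe Bool

  -- The state after j steps; steps after halting are empty.
  run : InputSet n → ℕ → State n
  run x zero    = init x
  run x (suc j) = if halted (run x j) then run x j else step (run x j)

-- Only algorithms that determine every non-empty subset are considered.
record Algorithm : Set₁ where
  field
    machine : Machine

  open Machine machine public

  field
    undetermined-initially : (x : InputSet n) (s : Subset n) →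
      Nonempty s → T (is-nothing (verdict (init x) s))
    verdict-correct : (x : InputSet n) (j : ℕ) (s : Subset n) (v : Bool) →
      Nonempty s → verdict (run x j) s ≡ just v →
      v ≡ does (isSubsetSolution? x s)
    verdict-persists : (x : InputSet n) (j : ℕ) (s : Subset n) →
      Nonempty s → T (is-just (verdict (run x j) s)) →
      T (is-just (verdict (run x (suc j)) s))
    all-determined : (x : InputSet n) (j : ℕ) (s : Subset n) →
      Nonempty s → T (halted (run x j)) →
      T (is-just (verdict (run x j) s))

    -- The worst-case number of steps for input-sets of size n, that is, the
    -- least bound on the running times.
    steps          : ℕ → ℕ
    steps-suffice  : (x : InputSet n) → T (halted (run x (steps n)))
    steps-least    : (m : ℕ) → ((x : InputSet n) → T (halted (run x m))) →
      steps n ℕ.≤ m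

module _ (V : Algorithm) where
  open Algorithm V

  -- Step j : Fin (steps n), counted from 0, leads from run x j to run x (suc j).
  Checks : InputSet n → Fin (steps n) → Subset n → Set
  Checks x j s =
    Nonempty s ×
    T (is-nothing (verdict (run x (toℕ j)) s)) ×
    T (is-just (verdict (run x (suc (toℕ j))) s))

  checks? : (x : InputSet n) (j : Fin (steps n)) → Decidable (Checks x j)
  checks? x j s = nonempty? s ×-dec T? _ ×-dec T? _

  distribution : InputSet n → Vec ℕ (steps n)
  distribution {n} x =
    Vec.tabulate λ j → List.length (List.filter (checks? x j) (allSubsets n))

  DeterminesSolution : InputSet n → Fin (steps n) → Set
  DeterminesSolution x j = ∃ λ s → Checks x j s × IsSubsetSolution x s

  determinesSolution? : (x : InputSet n) (j : Fin (steps n)) →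
                        Dec (DeterminesSolution x j)
  determinesSolution? x j =
    anySubset? λ s → checks? x j s ×-dec isSubsetSolution? x s

  outcome : Fin (steps n) → InputSet n → ℕ
  outcome j x = if does (determinesSolution? x j) then 1 else 0

MainStep : {k : ℕ} → Vec ℕ k → Fin k → Set
MainStep d j = 0 ℕ.< Vec.lookup d j

IsP₁ : Algorithm → Set
IsP₁ V = ∀ {n} (x : InputSet n) (j : Fin (steps n)) →
  MainStep (distribution V x) j → Vec.lookup (distribution V x) j ≡ 1
  where open Algorithm V

Infinite : Pred A ℓ → Set _
Infinite {A = A} C = ¬ (Σ (List A) λ xs → ∀ x → C x → x ∈ xs)

record IsInputClass (V : Algorithm) (n : ℕ) (d : Vec ℕ (Algorithm.steps V n))
                    (C : Pred (InputSet n) ℓ) : Set ℓ where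
  field
    infinite          : Infinite C
    same-distribution : ∀ x → C x → distribution V x ≡ d

------------------------------------------------------------------------
-- Real numbers, as two-sided Dedekind cuts

record ℝ : Set₁ where
  field
    -- Lower p means p < x, Upper p means x < p.
    Lower Upper     : ℚ → Set
    lower-inhabited : ∃ Lower
    upper-inhabited : ∃ Upper
    lower-rounded   : ∀ p → Lower p ⇔ (∃ λ r → p ℚ.< r × Lower r)
    upper-rounded   : ∀ p → Upper p ⇔ (∃ λ r → r ℚ.< p × Upper r)
    disjoint        : ∀ p → ¬ (Lower p × Upper p)
    located         : ∀ {p r} → p ℚ.< r → Lower p ⊎ Upper r

open ℝ public

infix 4 _≤ᴿ_ _≃ᴿ_

_≤ᴿ_ : ℝ → ℝ → Set
x ≤ᴿ y = ∀ p → Lower x p → Lower y p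

_≃ᴿ_ : ℝ → ℝ → Set
x ≃ᴿ y = x ≤ᴿ y × y ≤ᴿ x

private
  q-1<q : ∀ q → q ℚ.- 1ℚ ℚ.< q
  q-1<q q = subst (q ℚ.- 1ℚ ℚ.<_) (ℚ.+-identityʳ q)
    (ℚ.+-monoʳ-< q (ℚ.negative⁻¹ (ℚ.- 1ℚ)))

  q<q+1 : ∀ q → q ℚ.< q ℚ.+ 1ℚ
  q<q+1 q = subst (ℚ._< q ℚ.+ 1ℚ) (ℚ.+-identityʳ q)
    (ℚ.+-monoʳ-< q (ℚ.positive⁻¹ 1ℚ))

  <-located : ∀ q {p r} → p ℚ.< r → p ℚ.< q ⊎ q ℚ.< r
  <-located q {p} p<r with ℚ.<-cmp p q
  ... | tri< p<q _ _  = inj₁ p<q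
  ... | tri≈ _ refl _ = inj₂ p<r
  ... | tri> _ _ q<p  = inj₂ (ℚ.<-trans q<p p<r)

fromℚ : ℚ → ℝ
fromℚ q = record
  { Lower           = ℚ._< q
  ; Upper           = q ℚ.<_
  ; lower-inhabited = q ℚ.- 1ℚ , q-1<q q
  ; upper-inhabited = q ℚ.+ 1ℚ , q<q+1 q
  ; lower-rounded   = λ p → mk⇔ ℚ.<-dense λ (r , p<r , r<q) → ℚ.<-trans p<r r<q
  ; upper-rounded   = λ p →
      mk⇔ (λ q<p → let r , q<r , r<p = ℚ.<-dense q<p in r , r<p , q<r)
          (λ (r , r<p , q<r) → ℚ.<-trans q<r r<p)
  ; disjoint        = λ p (p<q , q<p) → ℚ.<-asym p<q q<p
  ; located         = <-located q
  }

fromℚ-mono-≤ : ∀ {p q} → p ℚ.≤ q → fromℚ p ≤ᴿ fromℚ q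
fromℚ-mono-≤ p≤q r r<p = ℚ.<-≤-trans r<p p≤q

-- The usual topology of ℝ: the open intervals with rational endpoints are a base.
_∈⟨_,_⟩ : ℝ → ℚ → ℚ → Set
x ∈⟨ p , r ⟩ = Lower x p × Upper x r

IsOpenᴿ : Pred ℝ ℓ → Set (lsuc 0ℓ ⊔ ℓ)
IsOpenᴿ W = ∀ x → W x →
  Σ ℚ λ p → Σ ℚ λ r → x ∈⟨ p , r ⟩ × (∀ y → y ∈⟨ p , r ⟩ → W y)

-- The topology induced on A by a map A → ℝ.
IsInducedOpen : (A → ℝ) → Pred A ℓ → Set _
IsInducedOpen {ℓ = ℓ} ι O =
  Σ (Pred ℝ ℓ) λ W → IsOpenᴿ W × (∀ x → O x ⇔ W (ι x))

record ℚ[0,1] : Set where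
  field
    value   : ℚ
    0≤value : 0ℚ ℚ.≤ value
    value≤1 : value ℚ.≤ 1ℚ

record ℝ[0,1] : Set₁ where
  field
    value   : ℝ
    0≤value : fromℚ 0ℚ ≤ᴿ value
    value≤1 : value ≤ᴿ fromℚ 1ℚ

-- Continuity for the topologies induced from ℝ; ℓ is the universe level of
-- the open sets.
Continuous : ∀ ℓ → (ℚ[0,1] → ℝ[0,1]) → Set _
Continuous ℓ f = (O : Pred ℝ[0,1] ℓ) →
  IsInducedOpen ℝ[0,1].value O → IsInducedOpen (fromℚ ∘ ℚ[0,1].value) (O ∘ f)

------------------------------------------------------------------------
-- The random experiment

box : A → A → {a b : ℕ} → a ℕ.≤ b → Vec A b
box S T {a} {b} a≤b =
  Vec.cast (ℕ.m+[n∸m]≡n a≤b) (Vec.replicate a S Vec.++ Vec.replicate (b ℕ.∸ a) T)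

-- The probability of the event P when one of the entries of xs is selected, all
-- entries being equally likely.
prob : {P : Pred A ℓ} → Decidable P → {b : ℕ} .{{_ : NonZero b}} → Vec A b → ℚ
prob P? {b} xs = + Vec.count P? xs / b

private
  m/n≤1 : ∀ m n .{{_ : NonZero n}} → m ℕ.≤ n → + m / n ℚ.≤ 1ℚ
  m/n≤1 m n@(suc n-1) m≤n = ℚ.toℚᵘ-cancel-≤
    (ℚᵘ.≤-respˡ-≃ (ℚᵘ.≃-sym (ℚ.toℚᵘ-fromℚᵘ (mkℚᵘ (+ m) n-1)))
      (*≤* (subst₂ ℤ._≤_ (sym (ℤ.*-identityʳ (+ m))) (sym (ℤ.*-identityˡ (+ n)))
             (ℤ.+≤+ m≤n))))

0≤prob : {P : Pred A ℓ} (P? : Decidable P) {b : ℕ} .{{_ : NonZero b}} (xs : Vec A b) →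
         0ℚ ℚ.≤ prob P? xs
0≤prob P? {b} xs =
  ℚ.nonNegative⁻¹ _ {{ℚ.normalize-nonNeg (Vec.count P? xs) b}}

prob≤1 : {P : Pred A ℓ} (P? : Decidable P) {b : ℕ} .{{_ : NonZero b}} (xs : Vec A b) →
         prob P? xs ℚ.≤ 1ℚ
prob≤1 P? {b} xs = m/n≤1 (Vec.count P? xs) b (count≤n P? xs)

-- A way of writing q as a / b, not necessarily in lowest terms.
record Fraction (q : ℚ) : Set where
  field
    a b     : ℕ
    b≢0     : NonZero b
    a≤b     : a ℕ.≤ b
    a/b≡q   : (+ a / b) {{b≢0}} ≡ q

-- A choice, for every q, of the box B_{a/b} with a / b = q that is used for q.
BoxChoice : Set
BoxChoice = (q : ℚ[0,1]) → Fraction (ℚ[0,1].value q)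

p₁ : (V : Algorithm) → Fin (Algorithm.steps V n) → (S T : InputSet n) →
     BoxChoice → ℚ[0,1] → ℝ[0,1]
p₁ V i S T choice q = record
  { value   = fromℚ (prob X≟1 B)
  ; 0≤value = fromℚ-mono-≤ (0≤prob X≟1 B)
  ; value≤1 = fromℚ-mono-≤ (prob≤1 X≟1 B)
  }
  where
  open Fraction (choice q)
  instance
    b-nonZero : NonZero b
    b-nonZero = b≢0
  B : Vec (InputSet _) b
  B = box S T a≤b
  X≟1 : Decidable (λ x → outcome V i x ≡ 1)
  X≟1 x = outcome V i x ℕ.≟ 1

{-# OPTIONS --safe #-}
module Submission where

open import Defs
open import Data.Fin.Base using (Fin)
open import Data.Nat.Base using (ℕ)
open import Data.Product.Base using (_×_)
open import Data.Vec.Base using (Vec)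
open import Level using (Level)
open import Relation.Nullary using (¬_)
open import Relation.Unary using (Pred)

open import Data.Bool.Base using (if_then_else_)
open import Data.Integer.Base using (+_)
open import Data.Nat.Base using (zero; suc; _+_; _∸_; _≤_; NonZero)
open import Data.Nat.Properties using (+-identityʳ; m+[n∸m]≡n; _≟_)
open import Data.Product.Base using (_,_)
open import Data.Rational.Base using (_/_)
open import Data.Vec.Base using ([]; _∷_; _++_; replicate; cast; count)
open import Data.Vec.Properties using (cast-is-id)
open import Function.Base using (_∘_)
open import Function.Bundles using (mk⇔; module Equivalence)
open import Relation.Binary.PropositionalEquality using (_≡_; refl; sym; trans; cong; cong₂; subst; module ≡-Reasoning)
open import Relation.Nullary.Decidable using (yes; no; dec-true; dec-false)
open import Relation.Nullary.Negation using (contradiction)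
open import Relation.Unary using (Decidable)

private
  variable
    α π : Level
    A : Set α

module _ {P : Pred A π} (P? : Decidable P) where

  count-++ : ∀ {m n} (xs : Vec A m) (ys : Vec A n) →
             count P? (xs ++ ys) ≡ count P? xs + count P? ys
  count-++ []       ys = refl
  count-++ (x ∷ xs) ys with P? x
  ... | yes _ = cong suc (count-++ xs ys)
  ... | no  _ = count-++ xs ys

  count-cast : ∀ {m n} (eq : m ≡ n) (xs : Vec A m) → count P? (cast eq xs) ≡ count P? xs
  count-cast refl xs = cong (count P?) (cast-is-id refl xs)

  count-replicate-∈ : ∀ n {x} → P x → count P? (replicate n x) ≡ n
  count-replicate-∈ zero        px = refl
  count-replicate-∈ (suc n) {x} px with P? x
  ... | yes _  = cong suc (count-replicate-∈ n px)
  ... | no ¬px = contradiction px ¬px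

  count-replicate-∉ : ∀ n {x} → ¬ P x → count P? (replicate n x) ≡ 0
  count-replicate-∉ zero        ¬px = refl
  count-replicate-∉ (suc n) {x} ¬px with P? x
  ... | yes px = contradiction px ¬px
  ... | no _   = count-replicate-∉ n ¬px

  count-box : ∀ {x y} → P x → ¬ P y → ∀ {a b} (a≤b : a ≤ b) → count P? (box x y a≤b) ≡ a
  count-box {x} {y} px ¬py {a} {b} a≤b = begin
    count P? (box x y a≤b)
      ≡⟨ count-cast (m+[n∸m]≡n a≤b) (replicate a x ++ replicate (b ∸ a) y) ⟩
    count P? (replicate a x ++ replicate (b ∸ a) y)
      ≡⟨ count-++ (replicate a x) (replicate (b ∸ a) y) ⟩
    count P? (replicate a x) + count P? (replicate (b ∸ a) y)
      ≡⟨ cong₂ _+_ (count-replicate-∈ a px) (count-replicate-∉ (b ∸ a) ¬py) ⟩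
    a + 0
      ≡⟨ +-identityʳ a ⟩
    a ∎
    where open ≡-Reasoning

  prob-box : ∀ {x y} → P x → ¬ P y → ∀ {a b} .{{_ : NonZero b}} (a≤b : a ≤ b) →
             prob P? (box x y a≤b) ≡ + a / b
  prob-box px ¬py {b = b} a≤b = cong (λ m → + m / b) (count-box px ¬py a≤b)

module _ (V : Algorithm) {n : ℕ} (i : Fin (Algorithm.steps V n)) (x : InputSet n) where

  outcome≡1 : DeterminesSolution V x i → outcome V i x ≡ 1
  outcome≡1 det = cong (if_then 1 else 0) (dec-true (determinesSolution? V x i) det)

  outcome≢1 : ¬ DeterminesSolution V x i → ¬ outcome V i x ≡ 1
  outcome≢1 ¬det eq
    with () ← trans (sym eq) (cong (if_then 1 else 0) (dec-false (determinesSolution? V x i) ¬det))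

≃ᴿ-reflexive : ∀ {x y} → x ≡ y → x ≃ᴿ y
≃ᴿ-reflexive refl = (λ _ l → l) , (λ _ l → l)

-- The open set of ℝ that induces O also induces its preimage under f.
value-preserving⇒continuous : ∀ {ℓ} (f : ℚ[0,1] → ℝ[0,1]) →
  (∀ q → ℝ[0,1].value (f q) ≡ fromℚ (ℚ[0,1].value q)) → Continuous ℓ f
value-preserving⇒continuous f f≡ O (W , W-open , O⇔W) =
  W , W-open , λ q → let open Equivalence (O⇔W (f q)) in
    mk⇔ (subst W (f≡ q) ∘ to) (from ∘ subst W (sym (f≡ q)))

mainTheorem1 : ∀ {c ℓ : Level} (V : Algorithm) → IsP₁ V →
    (n : ℕ) (d : Vec ℕ (Algorithm.steps V n)) (i : Fin (Algorithm.steps V n)) → MainStep d i →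
    (V-input : Pred (InputSet n) c) → IsInputClass V n d V-input →
    (S T : InputSet n) → V-input S → V-input T →
    DeterminesSolution V S i → ¬ DeterminesSolution V T i →
    (choice : BoxChoice) →
    (∀ q → ℝ[0,1].value (p₁ V i S T choice q) ≃ᴿ fromℚ (ℚ[0,1].value q)) × Continuous ℓ (p₁ V i S T choice)
mainTheorem1 V _ n d i _ _ _ S T _ _ S-det T-¬det choice =
  (λ q → ≃ᴿ-reflexive (p₁≡ q)) , value-preserving⇒continuous (p₁ V i S T choice) p₁≡
  where
  p₁≡ : ∀ q → ℝ[0,1].value (p₁ V i S T choice q) ≡ fromℚ (ℚ[0,1].value q)
  p₁≡ q = cong fromℚ (trans
    (prob-box (λ x → outcome V i x ≟ 1) (outcome≡1 V i S S-det) (outcome≢1 V i T T-¬det) {{b≢0}} a≤b)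
    a/b≡q)
    where open Fraction (choice q)
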